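{- Let $\alpha,\beta\in[0,1]$. If $G$ is a graph on $n$ vertices and $\mathrm{Z}_{\alpha,\beta}(G)=1$, then $G$ is (isomorphic to) the path $P_n$ on $n$ vertices.
   Context: All graphs are finite and simple with nonempty vertex set. Let $\alpha,\beta\in[0,1]$ (the transmission proportion and the transmission threshold), let $G$ be a graph and $B\subseteq V(G)$ a set of initially filled vertices. The transmission forcing process started from $B$ is defined as follows. Put $B_0=B$, $w_0(v)=1$ for $v\in B$ and $w_0(v)=0$ for $v\in V(G)\setminus B$. For $t\ge 1$, given the set $B_{t-1}$ of vertices filled at time $t-1$ and the weights $w_{t-1}$: for each unfilled vertex $u\in V(G)\setminus B_{t-1}$ let $\mathcal V_{t,u}$ be the set of all $v\in B_{t-1}$ such that $u$ is the only neighbor of $v$ in $V(G)\setminus B_{t-1}$ and $v\notin \mathcal V_{s,u'}$ for every $s<t$ and every $u'$ (each vertex transmits weight at most once); when $v\in\mathcal V_{t,u}$ we say $v$ forces $u$, written $v\to u$. Set $w_t(u)=w_{t-1}(u)+\sum_{v\in\mathcal V_{t,u}}\alpha\, w_{t-1}(v)$ for $u\in V(G)\setminus B_{t-1}$ and $w_t(u)=w_{t-1}(u)$ for $u\in B_{t-1}$. Then $B_t=B_{t-1}\cup\{u\in V(G)\setminus B_{t-1} : w_t(u)\ge\beta\}$. The set $B$ is an $(\alpha,\beta)$-transmission zero forcing set of $G$ if $B_t=V(G)$ for some $t\ge 0$, and the $(\alpha,\beta)$-transmission zero forcing number $\mathrm{Z}_{\alpha,\beta}(G)$ is the minimum cardinality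 of such a set. -}

module Defs where

open import Data.Empty using (⊥)
open import Data.Fin as Fin using (Fin; toℕ)
open import Data.Fin.Properties using (all?; any?)
open import Data.Fin.Subset using (Subset; _∈_; _∉_; ⊤; ∣_∣)
open import Data.Fin.Subset.Properties using (_∈?_)
open import Data.List.Base using (List; allFin; filter; foldr; map)
open import Data.Nat as ℕ using (ℕ; zero; suc; _⊔_)
import Data.Nat.Properties as ℕ
open import Data.Product using (∃-syntax; _×_; _,_)
open import Data.Rational as ℚ using (ℚ; 0ℚ; 1ℚ; ½)
import Data.Rational.Properties as ℚ
open import Data.Rational.Solver using (module +-*-Solver)
open import Data.Sum using (_⊎_; inj₁; inj₂)
open import Function.Bundles using (_⇔_; _↔_; Inverse)
open import Level using (0ℓ)
open import Relation.Binary.Core using (Rel)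
open import Relation.Binary.Definitions using (Symmetric; Irreflexive; Decidable)
open import Relation.Binary.PropositionalEquality
open import Relation.Nullary using (¬_; Dec; yes; no)
open import Relation.Nullary.Decidable using (_×-dec_; _⊎-dec_; _→-dec_; ¬?)

-- Real numbers as Cauchy sequences of rationals.  Two sequences denote the
-- same real when each is ≤ℝ the other.

IsCauchy : (ℕ → ℚ) → Set
IsCauchy f = ∀ ε → 0ℚ ℚ.< ε →
  ∃[ N ] (∀ m n → N ℕ.≤ m → N ℕ.≤ n → ℚ.∣ f m ℚ.- f n ∣ ℚ.≤ ε)

record ℝ : Set where
  constructor mkℝ
  field
    seq    : ℕ → ℚ
    cauchy : IsCauchy seq

open ℝ public

infix  4 _≤ℝ_
infixl 6 _+ℝ_
infixl 7 _*ℝ_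

-- lim x ≤ lim y; the ε makes the relation independent of the chosen
-- representatives.
_≤ℝ_ : ℝ → ℝ → Set
x ≤ℝ y = ∀ ε → 0ℚ ℚ.< ε → ∃[ N ] (∀ n → N ℕ.≤ n → seq x n ℚ.≤ seq y n ℚ.+ ε)

fromℚ : ℚ → ℝ
fromℚ q = mkℝ (λ _ → q) λ ε 0<ε → 0 , λ _ _ _ _ →
  subst (λ r → ℚ.∣ r ∣ ℚ.≤ ε) (sym (ℚ.+-inverseʳ q)) (ℚ.<⇒≤ 0<ε)

0ℝ 1ℝ : ℝ
0ℝ = fromℚ 0ℚ
1ℝ = fromℚ 1ℚ

private abstract
  halves : ∀ ε → ½ ℚ.* ε ℚ.+ ½ ℚ.* ε ≡ ε
  halves ε = trans (sym (ℚ.*-distribʳ-+ ε ½ ½)) (ℚ.*-identityˡ ε)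

  half-pos : ∀ ε → 0ℚ ℚ.< ε → 0ℚ ℚ.< ½ ℚ.* ε
  half-pos ε 0<ε = ℚ.positive⁻¹ _ {{ℚ.pos*pos⇒pos ½ ε {{ℚ.positive 0<ε}}}}

  +-cauchy : ∀ f g → IsCauchy f → IsCauchy g → IsCauchy (λ n → f n ℚ.+ g n)
  +-cauchy f g cf cg ε 0<ε
    with cf (½ ℚ.* ε) (half-pos ε 0<ε) | cg (½ ℚ.* ε) (half-pos ε 0<ε)
  ... | M , pf | N , pg = M ⊔ N , λ m n p q → begin
    ℚ.∣ (f m ℚ.+ g m) ℚ.- (f n ℚ.+ g n) ∣
      ≡⟨ cong ℚ.∣_∣ (rearrange (f m) (g m) (f n) (g n)) ⟩
    ℚ.∣ (f m ℚ.- f n) ℚ.+ (g m ℚ.- g n) ∣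
      ≤⟨ ℚ.∣p+q∣≤∣p∣+∣q∣ (f m ℚ.- f n) (g m ℚ.- g n) ⟩
    ℚ.∣ f m ℚ.- f n ∣ ℚ.+ ℚ.∣ g m ℚ.- g n ∣
      ≤⟨ ℚ.+-mono-≤ (pf m n (ℕ.m⊔n≤o⇒m≤o M N p) (ℕ.m⊔n≤o⇒m≤o M N q))
                    (pg m n (ℕ.m⊔n≤o⇒n≤o M N p) (ℕ.m⊔n≤o⇒n≤o M N q)) ⟩
    ½ ℚ.* ε ℚ.+ ½ ℚ.* ε
      ≡⟨ halves ε ⟩
    ε ∎
    where
    open ℚ.≤-Reasoning
    rearrange : ∀ a b c d →
      (a ℚ.+ b) ℚ.- (c ℚ.+ d) ≡ (a ℚ.- c) ℚ.+ (b ℚ.- d)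
    rearrange = solve 4 (λ a b c d →
      (a :+ b) :- (c :+ d) := (a :- c) :+ (b :- d)) refl
      where open +-*-Solver

  bounded : ∀ f → IsCauchy f →
    ∃[ N ] ∃[ K ] (0ℚ ℚ.< K × (∀ n → N ℕ.≤ n → ℚ.∣ f n ∣ ℚ.≤ K))
  bounded f cf with cf 1ℚ (ℚ.positive⁻¹ 1ℚ)
  ... | N , p = N , 1ℚ ℚ.+ ℚ.∣ f N ∣
    , ℚ.positive⁻¹ _ {{ℚ.pos+nonNeg⇒pos 1ℚ ℚ.∣ f N ∣ {{ℚ.∣-∣-nonNeg (f N)}}}}
    , λ n N≤n → begin
        ℚ.∣ f n ∣
          ≡⟨ cong ℚ.∣_∣ (split (f n) (f N)) ⟩
        ℚ.∣ (f n ℚ.- f N) ℚ.+ f N ∣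
          ≤⟨ ℚ.∣p+q∣≤∣p∣+∣q∣ (f n ℚ.- f N) (f N) ⟩
        ℚ.∣ f n ℚ.- f N ∣ ℚ.+ ℚ.∣ f N ∣
          ≤⟨ ℚ.+-monoˡ-≤ ℚ.∣ f N ∣ (p n N N≤n ℕ.≤-refl) ⟩
        1ℚ ℚ.+ ℚ.∣ f N ∣ ∎
    where
    open ℚ.≤-Reasoning
    split : ∀ a b → a ≡ (a ℚ.- b) ℚ.+ b
    split = solve 2 (λ a b → a := (a :- b) :+ b) refl
      where open +-*-Solver

  *-mono-abs : ∀ {K δ} a b → ℚ.∣ a ∣ ℚ.≤ K → ℚ.∣ b ∣ ℚ.≤ δ → 0ℚ ℚ.< K →
    ℚ.∣ a ℚ.* b ∣ ℚ.≤ K ℚ.* δ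
  *-mono-abs {K} {δ} a b a≤K b≤δ 0<K = begin
    ℚ.∣ a ℚ.* b ∣       ≡⟨ ℚ.∣p*q∣≡∣p∣*∣q∣ a b ⟩
    ℚ.∣ a ∣ ℚ.* ℚ.∣ b ∣ ≤⟨ ℚ.*-monoʳ-≤-nonNeg ℚ.∣ b ∣ {{ℚ.∣-∣-nonNeg b}} a≤K ⟩
    K ℚ.* ℚ.∣ b ∣       ≤⟨ ℚ.*-monoˡ-≤-nonNeg K {{ℚ.nonNegative (ℚ.<⇒≤ 0<K)}} b≤δ ⟩
    K ℚ.* δ             ∎
    where open ℚ.≤-Reasoning

  divide : ∀ M ε → 0ℚ ℚ.< M → 0ℚ ℚ.< ε → ∃[ δ ] (0ℚ ℚ.< δ × M ℚ.* δ ≡ ε)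
  divide M ε 0<M 0<ε = (ℚ.1/ M) ℚ.* ε
    , ℚ.positive⁻¹ _ {{ℚ.pos*pos⇒pos (ℚ.1/ M) {{ℚ.1/pos⇒pos M}} ε {{ℚ.positive 0<ε}}}}
    , trans (sym (ℚ.*-assoc M (ℚ.1/ M) ε))
        (trans (cong (ℚ._* ε) (ℚ.*-inverseʳ M)) (ℚ.*-identityˡ ε))
    where
    instance
      M-pos : ℚ.Positive M
      M-pos = ℚ.positive 0<M
      M-nonZero : ℚ.NonZero M
      M-nonZero = ℚ.pos⇒nonZero M

  *-close : ∀ {K L δ} a b c d → 0ℚ ℚ.< K → 0ℚ ℚ.< L →
    ℚ.∣ a ∣ ℚ.≤ K → ℚ.∣ d ∣ ℚ.≤ L → ℚ.∣ a ℚ.- c ∣ ℚ.≤ δ → ℚ.∣ b ℚ.- d ∣ ℚ.≤ δ →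
    ℚ.∣ a ℚ.* b ℚ.- c ℚ.* d ∣ ℚ.≤ (K ℚ.+ L) ℚ.* δ
  *-close {K} {L} {δ} a b c d 0<K 0<L a≤K d≤L a-c≤δ b-d≤δ = begin
    ℚ.∣ a ℚ.* b ℚ.- c ℚ.* d ∣
      ≡⟨ cong ℚ.∣_∣ (rearrange a b c d) ⟩
    ℚ.∣ a ℚ.* (b ℚ.- d) ℚ.+ d ℚ.* (a ℚ.- c) ∣
      ≤⟨ ℚ.∣p+q∣≤∣p∣+∣q∣ (a ℚ.* (b ℚ.- d)) (d ℚ.* (a ℚ.- c)) ⟩
    ℚ.∣ a ℚ.* (b ℚ.- d) ∣ ℚ.+ ℚ.∣ d ℚ.* (a ℚ.- c) ∣
      ≤⟨ ℚ.+-mono-≤ (*-mono-abs a (b ℚ.- d) a≤K b-d≤δ 0<K)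
                    (*-mono-abs d (a ℚ.- c) d≤L a-c≤δ 0<L) ⟩
    K ℚ.* δ ℚ.+ L ℚ.* δ
      ≡⟨ ℚ.*-distribʳ-+ δ K L ⟨
    (K ℚ.+ L) ℚ.* δ ∎
    where
    open ℚ.≤-Reasoning
    rearrange : ∀ a b c d →
      a ℚ.* b ℚ.- c ℚ.* d ≡ a ℚ.* (b ℚ.- d) ℚ.+ d ℚ.* (a ℚ.- c)
    rearrange = solve 4 (λ a b c d →
      a :* b :- c :* d := a :* (b :- d) :+ d :* (a :- c)) refl
      where open +-*-Solver

  +-pos : ∀ p q → 0ℚ ℚ.< p → 0ℚ ℚ.< q → 0ℚ ℚ.< p ℚ.+ q
  +-pos p q 0<p 0<q =
    ℚ.positive⁻¹ (p ℚ.+ q) {{ℚ.pos+pos⇒pos p {{ℚ.positive 0<p}} q {{ℚ.positive 0<q}}}}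

  *-cauchy : ∀ f g → IsCauchy f → IsCauchy g → IsCauchy (λ n → f n ℚ.* g n)
  *-cauchy f g cf cg ε 0<ε =
    let N₁ , K , 0<K , f≤K = bounded f cf
        N₂ , L , 0<L , g≤L = bounded g cg
        δ , 0<δ , [K+L]δ≡ε = divide (K ℚ.+ L) ε (+-pos K L 0<K 0<L) 0<ε
        N₃ , pf = cf δ 0<δ
        N₄ , pg = cg δ 0<δ
    in (N₁ ⊔ N₂) ⊔ (N₃ ⊔ N₄) , λ m n p q →
    let p₁₂ = ℕ.m⊔n≤o⇒m≤o (N₁ ⊔ N₂) (N₃ ⊔ N₄) p
        q₁₂ = ℕ.m⊔n≤o⇒m≤o (N₁ ⊔ N₂) (N₃ ⊔ N₄) q
        p₃₄ = ℕ.m⊔n≤o⇒n≤o (N₁ ⊔ N₂) (N₃ ⊔ N₄) p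
        q₃₄ = ℕ.m⊔n≤o⇒n≤o (N₁ ⊔ N₂) (N₃ ⊔ N₄) q
    in subst (ℚ.∣ f m ℚ.* g m ℚ.- f n ℚ.* g n ∣ ℚ.≤_) [K+L]δ≡ε
      (*-close {K} {L} {δ} (f m) (g m) (f n) (g n) 0<K 0<L
        (f≤K m (ℕ.m⊔n≤o⇒m≤o N₁ N₂ p₁₂))
        (g≤L n (ℕ.m⊔n≤o⇒n≤o N₁ N₂ q₁₂))
        (pf m n (ℕ.m⊔n≤o⇒m≤o N₃ N₄ p₃₄) (ℕ.m⊔n≤o⇒m≤o N₃ N₄ q₃₄))
        (pg m n (ℕ.m⊔n≤o⇒n≤o N₃ N₄ p₃₄) (ℕ.m⊔n≤o⇒n≤o N₃ N₄ q₃₄)))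

_+ℝ_ : ℝ → ℝ → ℝ
x +ℝ y = mkℝ (λ n → seq x n ℚ.+ seq y n) (+-cauchy (seq x) (seq y) (cauchy x) (cauchy y))

_*ℝ_ : ℝ → ℝ → ℝ
x *ℝ y = mkℝ (λ n → seq x n ℚ.* seq y n) (*-cauchy (seq x) (seq y) (cauchy x) (cauchy y))

sumℝ : List ℝ → ℝ
sumℝ = foldr _+ℝ_ 0ℝ

InUnitInterval : ℝ → Set
InUnitInterval x = 0ℝ ≤ℝ x × x ≤ℝ 1ℝ

record Graph (n : ℕ) : Set₁ where
  field
    _~_      : Rel (Fin n) 0ℓ
    _~?_     : Decidable _~_
    ~-sym    : Symmetric _~_
    ~-irrefl : Irreflexive _≡_ _~_

record _≅_ {m n : ℕ} (G : Graph m) (H : Graph n) : Set where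
  private
    module G = Graph G
    module H = Graph H
  field
    bijection : Fin m ↔ Fin n
    adjacency : ∀ u v → u G.~ v ⇔ Inverse.to bijection u H.~ Inverse.to bijection v

path : ∀ n → Graph n
path n = record
  { _~_      = λ u v → suc (toℕ u) ≡ toℕ v ⊎ suc (toℕ v) ≡ toℕ u
  ; _~?_     = λ u v → (suc (toℕ u) ℕ.≟ toℕ v) ⊎-dec (suc (toℕ v) ℕ.≟ toℕ u)
  ; ~-sym    = λ { (inj₁ p) → inj₂ p ; (inj₂ p) → inj₁ p }
  ; ~-irrefl = λ { refl (inj₁ p) → ℕ.1+n≢n p ; refl (inj₂ p) → ℕ.1+n≢n p }
  }

module Transmission {n : ℕ} (G : Graph n) (α β : ℝ) where
  open Graph G

  -- β ≤ w is undecidable for reals, so the sets B₀, B₁, … cannot be computed.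
  -- Instead the forces and the weights are computed from a given sequence of
  -- sets, and IsProcess then says that the sequence obeys the filling rule;
  -- this determines the sequence uniquely.
  module _ (B : ℕ → Subset n) where

    -- Forces t v u: v ∈ 𝒱_{t,u}.
    -- Transmitted t v: v ∈ 𝒱_{s,u} for some s ≤ t and some u.
    Forces      : ℕ → Fin n → Fin n → Set
    Transmitted : ℕ → Fin n → Set

    Forces zero    v u = ⊥
    Forces (suc t) v u =
      v ∈ B t × u ∉ B t × v ~ u × (∀ x → v ~ x → x ∉ B t → x ≡ u) × ¬ Transmitted t v

    Transmitted zero    v = ⊥
    Transmitted (suc t) v = Transmitted t v ⊎ ∃[ u ] Forces (suc t) v u

    forces?      : ∀ t v u → Dec (Forces t v u)
    transmitted? : ∀ t v → Dec (Transmitted t v)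

    forces? zero    v u = no λ ()
    forces? (suc t) v u =
      (v ∈? B t) ×-dec ¬? (u ∈? B t) ×-dec (v ~? u)
        ×-dec all? (λ x → (v ~? x) →-dec (¬? (x ∈? B t) →-dec (x Fin.≟ u)))
        ×-dec ¬? (transmitted? t v)

    transmitted? zero    v = no λ ()
    transmitted? (suc t) v = transmitted? t v ⊎-dec any? (forces? (suc t) v)

    forcers : ℕ → Fin n → List (Fin n)
    forcers t u = filter (λ v → forces? t v u) (allFin n)

    weight : ℕ → Fin n → ℝ
    weight zero u with u ∈? B 0
    ... | yes _ = 1ℝ
    ... | no  _ = 0ℝ
    weight (suc t) u with u ∈? B t
    ... | yes _ = weight t u
    ... | no  _ = weight t u +ℝ sumℝ (map (λ v → α *ℝ weight t v) (forcers (suc t) u))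

  record IsProcess (S : Subset n) (B : ℕ → Subset n) : Set where
    field
      initial : B 0 ≡ S
      step    : ∀ t u →
        u ∈ B (suc t) ⇔ (u ∈ B t ⊎ (u ∉ B t × β ≤ℝ weight B (suc t) u))

  IsForcingSet : Subset n → Set
  IsForcingSet S = ∃[ B ] (IsProcess S B × ∃[ t ] B t ≡ ⊤)

  -- The (α,β)-transmission zero forcing number, as a relation: k is the
  -- minimum cardinality of a forcing set.
  IsForcingNumber : ℕ → Set
  IsForcingNumber k =
    (∃[ S ] (IsForcingSet S × ∣ S ∣ ≡ k)) ×
    (∀ S → IsForcingSet S → k ℕ.≤ ∣ S ∣)

{-# OPTIONS --safe #-}
-- Once the case β ≤ 0 is excluded (there the empty set already fills G), an
-- unfilled vertex that receives no transmission at some step is not filled at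
-- that step.  Starting from a single vertex, the filled vertices always form an
-- induced path all of whose vertices, except possibly the newest, have only
-- filled neighbors.  Hence the newest vertex is the only one able to force, and
-- each time it fills its unique unfilled neighbor the path grows by one vertex.
module Submission where

open import Defs
open import Data.Bool.Base using (true; false)
open import Data.Fin.Base using (Fin; zero; suc)
open import Data.Fin.Permutation using (↔⇒≡)
open import Data.Fin.Properties using (any?)
open import Data.Fin.Subset using (Subset; _∈_; _∉_; _-_; ⊤; ⊥; ⁅_⁆; ∣_∣)
open import Data.Fin.Subset.Properties
open import Data.List.Base using (map; allFin)
import Data.List.Relation.Unary.All as List
open import Data.List.Properties using (filter-none)
open import Data.Nat using (ℕ; zero; suc; _≤_; _<_; NonZero)
import Data.Nat.Properties as ℕ
open import Data.Product using (∃-syntax; _×_; _,_; proj₁)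
import Data.Rational as ℚ
import Data.Rational.Properties as ℚ
open import Data.Sum using (_⊎_; inj₁; inj₂)
open import Data.Vec.Base using (Vec; []; _∷_; lookup)
import Data.Vec.Membership.Propositional as Vec
open import Data.Vec.Membership.Propositional.Properties using (∈-lookup)
open import Data.Vec.Relation.Unary.Any using (here; there; index)
open import Data.Vec.Relation.Unary.Any.Properties using (lookup-index)
open import Function.Base using (_∘_)
open import Function.Bundles using (_⇔_; _↔_; mk⇔; mk↔ₛ′; Equivalence)
open import Relation.Binary.PropositionalEquality
open import Relation.Nullary using (¬_; yes; no; contradiction)
open import Relation.Nullary.Decidable using (_×-dec_; ¬?)

-- Termwise agreement replaces `x ≡ y` because elements of `ℝ` also carry a Cauchy proof: adding an
-- empty sum preserves every term of a weight but builds a different record.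
≤ℝ-respʳ : ∀ z x y → (∀ k → seq x k ≡ seq y k) → z ≤ℝ x → z ≤ℝ y
≤ℝ-respʳ z _ _ x≗y z≤x ε 0<ε with z≤x ε 0<ε
... | N , bound = N , λ k N≤k →
  subst (λ q → seq z k ℚ.≤ q ℚ.+ ε) (x≗y k) (bound k N≤k)

∣p∣≡0⇒p≡⊥ : ∀ {n} (p : Subset n) → ∣ p ∣ ≡ 0 → p ≡ ⊥
∣p∣≡0⇒p≡⊥ p ∣p∣≡0 = Empty-unique λ { (x , x∈p) →
  ℕ.n≮0 (subst (∣ p - x ∣ <_) ∣p∣≡0 (x∈p⇒∣p-x∣<∣p∣ x∈p)) }

∣p∣≡1⇒singleton : ∀ {n} (p : Subset n) → ∣ p ∣ ≡ 1 → ∃[ x ] p ≡ ⁅ x ⁆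
∣p∣≡1⇒singleton (true ∷ p) ∣p∣≡1 =
  zero , cong (true ∷_) (∣p∣≡0⇒p≡⊥ p (ℕ.suc-injective ∣p∣≡1))
∣p∣≡1⇒singleton (false ∷ p) ∣p∣≡1 with ∣p∣≡1⇒singleton p ∣p∣≡1
... | x , p≡⁅x⁆ = suc x , cong (false ∷_) p≡⁅x⁆

module InducedPaths {n : ℕ} (G : Graph n) where
  open Graph G

  -- Newest vertex first.
  data InducedPath : ∀ {m} → Vec (Fin n) m → Set where
    single : ∀ s → InducedPath (s ∷ [])
    extend : ∀ {m u v} {xs : Vec (Fin n) m} → InducedPath (v ∷ xs) →
      u Vec.∉ (v ∷ xs) → v ~ u → (∀ {x} → x Vec.∈ xs → ¬ x ~ u) →
      InducedPath (u ∷ v ∷ xs)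

  lookup-injective : ∀ {m} {xs : Vec (Fin n) m} → InducedPath xs →
    ∀ i j → lookup xs i ≡ lookup xs j → i ≡ j
  lookup-injective _ zero zero _ = refl
  lookup-injective (extend {v = v} {xs} _ u∉ _ _) zero (suc j) eq =
    contradiction (subst (Vec._∈ _) (sym eq) (∈-lookup j (v ∷ xs))) u∉
  lookup-injective (extend {v = v} {xs} _ u∉ _ _) (suc i) zero eq =
    contradiction (subst (Vec._∈ _) eq (∈-lookup i (v ∷ xs))) u∉
  lookup-injective (extend p _ _ _) (suc i) (suc j) eq =
    cong suc (lookup-injective p i j eq)

  path-suc : ∀ {m} {i j : Fin m} → Graph._~_ (path m) i j ⇔
    Graph._~_ (path (suc m)) (suc i) (suc j)
  path-suc = mk⇔
    (λ { (inj₁ p) → inj₁ (cong suc p) ; (inj₂ p) → inj₂ (cong suc p) })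
    (λ { (inj₁ p) → inj₁ (ℕ.suc-injective p) ; (inj₂ p) → inj₂ (ℕ.suc-injective p) })

  -- Induction on the path: the newest vertex, at index `zero`, was attached to its successor in the
  -- vector and to nothing older, so its only possible partner is index 1.
  lookup-adjacent : ∀ {m} {xs : Vec (Fin n) m} → InducedPath xs →
    ∀ i j → lookup xs i ~ lookup xs j → Graph._~_ (path m) i j
  lookup-adjacent _ zero zero u~u = contradiction u~u (~-irrefl refl)
  lookup-adjacent (extend _ _ _ _) zero (suc zero) _ = inj₁ refl
  lookup-adjacent (extend _ _ _ _) (suc zero) zero _ = inj₂ refl
  lookup-adjacent (extend {xs = xs} _ _ _ ≁u) zero (suc (suc j)) u~x =
    contradiction (~-sym u~x) (≁u (∈-lookup j xs))
  lookup-adjacent (extend {xs = xs} _ _ _ ≁u) (suc (suc i)) zero x~u =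
    contradiction x~u (≁u (∈-lookup i xs))
  lookup-adjacent (extend p _ _ _) (suc i) (suc j) i~j =
    Equivalence.to path-suc (lookup-adjacent p i j i~j)

  adjacent-lookup : ∀ {m} {xs : Vec (Fin n) m} → InducedPath xs →
    ∀ i j → Graph._~_ (path m) i j → lookup xs i ~ lookup xs j
  adjacent-lookup _ zero zero (inj₁ ())
  adjacent-lookup _ zero zero (inj₂ ())
  adjacent-lookup (extend _ _ v~u _) zero (suc zero) _ = ~-sym v~u
  adjacent-lookup (extend _ _ v~u _) (suc zero) zero _ = v~u
  adjacent-lookup _ zero (suc (suc j)) (inj₁ ())
  adjacent-lookup _ zero (suc (suc j)) (inj₂ ())
  adjacent-lookup _ (suc (suc i)) zero (inj₁ ())
  adjacent-lookup _ (suc (suc i)) zero (inj₂ ())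
  adjacent-lookup (extend p _ _ _) (suc i) (suc j) i~j =
    adjacent-lookup p i j (Equivalence.from path-suc i~j)

  spanning⇒≅path : ∀ {m} {xs : Vec (Fin n) m} → InducedPath xs →
    (∀ u → u Vec.∈ xs) → G ≅ path n
  -- The length `m` is not known to be `n` in advance. The isomorphism is built onto `path m`, and
  -- the bijection `positions` itself supplies the equality needed for transport.
  spanning⇒≅path {m} {xs} p all∈ = subst (λ k → G ≅ path k) (sym (↔⇒≡ positions)) record
    { bijection = positions
    ; adjacency = λ u v → mk⇔
        (λ u~v → lookup-adjacent p (position u) (position v)
          (subst₂ _~_ (lookup-index (all∈ u)) (lookup-index (all∈ v)) u~v))
        (λ u~v → subst₂ _~_ (sym (lookup-index (all∈ u))) (sym (lookup-index (all∈ v)))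
          (adjacent-lookup p (position u) (position v) u~v))
    }
    where
    position : Fin n → Fin m
    position u = index (all∈ u)

    positions : Fin n ↔ Fin m
    positions = mk↔ₛ′ position (lookup xs)
      (λ i → lookup-injective p _ i (sym (lookup-index (all∈ (lookup xs i)))))
      (λ u → sym (lookup-index (all∈ u)))

module Filling {n : ℕ} (G : Graph n) (α β : ℝ) where
  open Graph G
  open Transmission G α β
  open InducedPaths G

  weight-initial : ∀ B u → u ∉ B 0 → weight B 0 u ≡ 0ℝ
  weight-initial B u u∉ with u ∈? B 0
  ... | yes u∈ = contradiction u∈ u∉
  ... | no  _  = refl

  weight-unforced : ∀ B t u → u ∉ B t → (∀ v → ¬ Forces B (suc t) v u) →
    ∀ k → seq (weight B (suc t) u) k ≡ seq (weight B t u) k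
  weight-unforced B t u u∉ unforced k with u ∈? B t
  ... | yes u∈ = contradiction u∈ u∉
  ... | no  _  = trans
    (cong (λ vs → seq (weight B t u +ℝ sumℝ (map (λ v → α *ℝ weight B t v) vs)) k)
      (filter-none (λ v → forces? B (suc t) v u) (List.universal unforced (allFin n))))
    (ℚ.+-identityʳ _)

  -- With nothing filled no vertex can force, so every weight is still zero at the first step and
  -- already meets the threshold; all vertices fill at once.
  ⊥-forces-if-β≤0 : β ≤ℝ 0ℝ → IsForcingSet ⊥
  ⊥-forces-if-β≤0 β≤0 = B , record { initial = refl ; step = step } , 1 , refl
    where
    B : ℕ → Subset n
    B zero    = ⊥
    B (suc _) = ⊤

    step : ∀ t u → u ∈ B (suc t) ⇔ (u ∈ B t ⊎ (u ∉ B t × β ≤ℝ weight B (suc t) u))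
    step zero u = mk⇔
      (λ _ → inj₂ (∉⊥ , ≤ℝ-respʳ β (weight B 0 u) (weight B 1 u)
        (λ k → sym (weight-unforced B 0 u ∉⊥ (λ _ → ∉⊥ ∘ proj₁) k))
        (subst (β ≤ℝ_) (sym (weight-initial B u ∉⊥)) β≤0)))
      (λ _ → ∈⊤)
    step (suc t) u = mk⇔ inj₁ (λ _ → ∈⊤)

  module Process {S B} (process : IsProcess S B) (β≰0 : ¬ β ≤ℝ 0ℝ) where
    open IsProcess process

    -- The filling rule tests exactly `weight B (suc t)` at step `suc t`, so a vertex that passed
    -- would be filled. The initial weight is never tested, which is why time zero needs `β≰0`.
    unfilled⇒β≰weight : ∀ t u → u ∉ B t → ¬ β ≤ℝ weight B t u
    unfilled⇒β≰weight zero u u∉ = β≰0 ∘ subst (β ≤ℝ_) (weight-initial B u u∉)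
    unfilled⇒β≰weight (suc t) u u∉ β≤w = u∉ (Equivalence.from (step t u)
      (inj₂ (u∉ ∘ Equivalence.from (step t u) ∘ inj₁ , β≤w)))

    filled-mono : ∀ t {u} → u ∈ B t → u ∈ B (suc t)
    filled-mono t {u} = Equivalence.from (step t u) ∘ inj₁

    -- Without a force the weight does not change, and it had not met the threshold before.
    newly-filled⇒forced : ∀ t u → u ∈ B (suc t) → u ∉ B t → ∃[ v ] Forces B (suc t) v u
    newly-filled⇒forced t u u∈ u∉
      with any? (λ v → forces? B (suc t) v u) | Equivalence.to (step t u) u∈
    ... | yes forced | _ = forced
    ... | no _       | inj₁ u∈′ = contradiction u∈′ u∉
    ... | no unforced | inj₂ (_ , β≤w) = contradiction
      (≤ℝ-respʳ β (weight B (suc t) u) (weight B t u)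
        (weight-unforced B t u u∉ (λ v f → unforced (v , f))) β≤w)
      (unfilled⇒β≰weight t u u∉)

    -- The invariant of the process. `size` is not tied to `t`, since a step may fill nothing;
    -- `saturated` exempts `newest`, which may still have unfilled neighbors.
    record PathFilled (t : ℕ) : Set where
      field
        {size}    : ℕ
        newest    : Fin n
        older     : Vec (Fin n) size
        isPath    : InducedPath (newest ∷ older)
        filled⇒∈  : ∀ {u} → u ∈ B t → u Vec.∈ (newest ∷ older)
        ∈⇒filled  : ∀ {u} → u Vec.∈ (newest ∷ older) → u ∈ B t
        saturated : ∀ {x y} → x Vec.∈ older → x ~ y → y ∈ B t

    pathFilled-suc : ∀ t → PathFilled t → PathFilled (suc t)
    pathFilled-suc t filled
      with any? (λ u → (u ∈? B (suc t)) ×-dec ¬? (u ∈? B t))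
    ... | no none = record
      { newest    = newest
      ; older     = older
      ; isPath    = isPath
      ; filled⇒∈  = λ {u} u∈ → filled⇒∈ (unchanged u u∈)
      ; ∈⇒filled  = filled-mono t ∘ ∈⇒filled
      ; saturated = λ x∈ x~y → filled-mono t (saturated x∈ x~y)
      }
      where
      open PathFilled filled
      unchanged : ∀ u → u ∈ B (suc t) → u ∈ B t
      unchanged u u∈ with u ∈? B t
      ... | yes u∈′ = u∈′
      ... | no  u∉  = contradiction (u , u∈ , u∉) none
    ... | yes (u , u∈ , u∉) = record
      { newest    = u
      ; older     = newest ∷ older
      -- An older vertex adjacent to `u` would, being saturated, have had `u` filled already.
      ; isPath    = extend isPath (u∉ ∘ ∈⇒filled) newest~u (λ x∈ x~u → u∉ (saturated x∈ x~u))
      ; filled⇒∈  = filled⇒∈′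
      ; ∈⇒filled  = λ { (here refl) → u∈ ; (there x∈) → filled-mono t (∈⇒filled x∈) }
      ; saturated = λ { (here refl) → newest-saturated
                      ; (there x∈) x~y → filled-mono t (saturated x∈ x~y) }
      }
      where
      open PathFilled filled

      -- A forcer is a filled vertex with an unfilled neighbor, which no vertex of `older` has.
      forcer-is-newest : ∀ {w v} → w ∉ B t → Forces B (suc t) v w → v ≡ newest
      forcer-is-newest w∉ (v∈ , _ , v~w , _) with filled⇒∈ v∈
      ... | here v≡  = v≡
      ... | there v∈ = contradiction (saturated v∈ v~w) w∉

      newest-forces : ∀ {w} → w ∈ B (suc t) → w ∉ B t → Forces B (suc t) newest w
      newest-forces {w} w∈ w∉ with newly-filled⇒forced t w w∈ w∉
      ... | v , f = subst (λ v → Forces B (suc t) v w) (forcer-is-newest w∉ f) f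

      newest~u : newest ~ u
      newest~u with newest-forces u∈ u∉
      ... | _ , _ , newest~u , _ = newest~u

      -- The uniqueness clause of `Forces` leaves `u` as the sole unfilled neighbor of `newest`.
      -- Hence no second vertex fills in this step, and `newest` becomes saturated.
      only-u : ∀ {w} → newest ~ w → w ∉ B t → w ≡ u
      only-u with newest-forces u∈ u∉
      ... | _ , _ , _ , only , _ = only _

      newest-saturated : ∀ {y} → newest ~ y → y ∈ B (suc t)
      newest-saturated {y} newest~y with y ∈? B t
      ... | yes y∈ = filled-mono t y∈
      ... | no  y∉ = subst (_∈ B (suc t)) (sym (only-u newest~y y∉)) u∈

      filled⇒∈′ : ∀ {w} → w ∈ B (suc t) → w Vec.∈ (u ∷ newest ∷ older)
      filled⇒∈′ {w} w∈ with w ∈? B t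
      ... | yes w∈′ = there (filled⇒∈ w∈′)
      ... | no  w∉ with newest-forces w∈ w∉
      ...   | _ , _ , newest~w , _ = here (only-u newest~w w∉)

    pathFilled : ∀ s → S ≡ ⁅ s ⁆ → ∀ t → PathFilled t
    pathFilled s refl zero = record
      { newest    = s
      ; older     = []
      ; isPath    = single s
      ; filled⇒∈  = λ {u} u∈ → here (x∈⁅y⁆⇒x≡y s (subst (u ∈_) initial u∈))
      ; ∈⇒filled  = λ { (here refl) → subst (s ∈_) (sym initial) (x∈⁅x⁆ s) }
      ; saturated = λ ()
      }
    pathFilled s S≡⁅s⁆ (suc t) = pathFilled-suc t (pathFilled s S≡⁅s⁆ t)

proposition3p2p1 : (α β : ℝ) → InUnitInterval α → InUnitInterval β →
    (n : ℕ) → .{{_ : NonZero n}} → (G : Graph n) →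
    Transmission.IsForcingNumber G α β 1 → G ≅ path n
proposition3p2p1 α β _ _ n G ((S , (B , process , t , Bt≡⊤) , ∣S∣≡1) , minimal)
  with ∣p∣≡1⇒singleton S ∣S∣≡1
... | s , S≡⁅s⁆ = spanning⇒≅path isPath λ u → filled⇒∈ (subst (u ∈_) (sym Bt≡⊤) ∈⊤)
  where
  open InducedPaths G
  open Filling G α β

  β≰0 : ¬ β ≤ℝ 0ℝ
  -- Minimality gives every forcing set at least one element, yet the empty set would be forcing.
  β≰0 β≤0 = ℕ.n≮0 (subst (1 ≤_) (∣⊥∣≡0 n) (minimal ⊥ (⊥-forces-if-β≤0 β≤0)))

  open Process process β≰0
  open PathFilled (pathFilled s S≡⁅s⁆ t)
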